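{- Let $S$ be a Stone space with $|S|\ge 3$ and $I$ a set of isolated points of $S$. Then $Q_6(I,S)=(S\cup\zeta(S);\tau,\le,\zeta)$ is a $pm$-space of height $1$.
   Context: A $pm$-space is $(P;\tau,\le,\zeta)$ where $(P;\tau,\le)$ is a Priestley space (compact, and whenever $y\not\le x$ there is a clopen decreasing set containing $x$ but not $y$), $[X)$ is clopen for every clopen decreasing $X\subseteq P$, and $\zeta$ is a continuous order-reversing involution. $Q_6(I,S)$ is $S\cup\zeta(S)$ where $\zeta(S)$ is a disjoint homeomorphic copy of $S$, $\tau$ is the disjoint union topology, $\zeta$ interchanges each $s\in S$ with its copy $\zeta(s)$, and $\le$ is the partial order whose only strict comparabilities are: for $x,y\in S$, $x<\zeta(y)$ iff ($x\ne y$ or $x\notin I$). -}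

module Defs where

open import Level using (Level; suc)
open import Algebra.Definitions using (Involutive)
open import Data.Fin.Base as Fin using (Fin)
open import Data.List.Base using (List)
open import Data.List.Relation.Unary.All using (All)
open import Data.List.Relation.Unary.Any using (Any)
open import Data.Nat.Base as ℕ using (ℕ)
open import Data.Product.Base using (∃; _×_; _,_; proj₁; proj₂)
open import Data.Sum.Base using (_⊎_; inj₁; inj₂; swap)
open import Function.Bundles using (_⇔_; mk⇔; Equivalence)
open import Relation.Binary.Construct.Closure.Reflexive using (ReflClosure)
open import Relation.Binary.Construct.NonStrictToStrict using (_<_)
open import Relation.Binary.Core using (Rel)
open import Relation.Binary.Definitions using (Antitonic₁; Monotonic₁)
open import Relation.Binary.PropositionalEquality using (_≡_; _≢_; refl)
open import Relation.Binary.Structures using (IsPartialOrder)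
open import Relation.Nullary.Negation using (¬_)
open import Relation.Unary using (Pred; _∈_; _∉_; _⊆_; _∩_; ∁; Universal; ｛_｝; _⊢_)

private
  variable
    a : Level

-- Families of subsets live one universe up, so that unions and covers range
-- over arbitrary sets of open sets.  The union of a family then lands in the
-- wrong universe; `IsUnion F W` says instead that the subset W has exactly
-- the points of that union.

Family : Set a → Set (suc (suc a))
Family {a} X = Pred (Pred X a) (suc a)

IsUnion : {X : Set a} → Family X → Pred X a → Set (suc a)
IsUnion F W = ∀ x → x ∈ W ⇔ ∃ λ V → V ∈ F × x ∈ V

-- The empty set is open as the union of the empty family, and openness is
-- invariant under extensional equality by taking one-member families.

record Topology (X : Set a) : Set (suc (suc a)) where
  field
    Open   : Family X
    U-open : ∀ {V} → Universal V → V ∈ Open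
    ∩-open : ∀ {V W} → V ∈ Open → W ∈ Open → V ∩ W ∈ Open
    ⋃-open : ∀ (F : Family X) {W} → F ⊆ Open → IsUnion F W → W ∈ Open

  Closed : Family X
  Closed V = ∁ V ∈ Open

  Clopen : Family X
  Clopen V = V ∈ Open × V ∈ Closed

  Isolated : Pred X (suc a)
  Isolated x = ｛ x ｝ ∈ Open

  Compact : Set (suc (suc a))
  Compact = (F : Family X) → F ⊆ Open →
            (∀ x → ∃ λ V → V ∈ F × x ∈ V) →
            ∃ λ (Vs : List (Pred X a)) →
              All (_∈ F) Vs × (∀ x → Any (x ∈_) Vs)

Continuous : {X Y : Set a} → Topology X → Topology Y → (X → Y) →
             Set (suc a)
Continuous τ σ f = ∀ {V} → V ∈ Topology.Open σ → f ⊢ V ∈ Topology.Open τ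

-- Total disconnectedness is meant as in Priestley duality: distinct points
-- are separated by a clopen set.  In particular the space is Hausdorff.

record IsStone {X : Set a} (τ : Topology X) : Set (suc (suc a)) where
  open Topology τ
  field
    compact             : Compact
    totallyDisconnected : ∀ {x y} → x ≢ y →
                          ∃ λ V → V ∈ Clopen × x ∈ V × y ∉ V

module _ {X : Set a} (_≤_ : Rel X a) where

  Decreasing : Pred X a → Set a
  Decreasing V = ∀ {x y} → y ≤ x → x ∈ V → y ∈ V

  [_⟩ : Pred X a → Pred X a
  [ V ⟩ y = ∃ λ x → x ∈ V × x ≤ y

  -- A chain of length n has n + 1 elements.

  Chain : ℕ → Set a
  Chain n = ∃ λ (c : Fin (ℕ.suc n) → X) → Monotonic₁ Fin._<_ (_<_ _≡_ _≤_) c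

  HasHeight : ℕ → Set a
  HasHeight n = Chain n × (∀ m → Chain m → m ℕ.≤ n)

record IsPriestley {X : Set a} (τ : Topology X) (_≤_ : Rel X a) :
                   Set (suc (suc a)) where
  open Topology τ
  field
    isPartialOrder           : IsPartialOrder _≡_ _≤_
    compact                  : Compact
    totallyOrderDisconnected : ∀ {x y} → ¬ (y ≤ x) →
                               ∃ λ V → V ∈ Clopen × Decreasing _≤_ V ×
                                       x ∈ V × y ∉ V

record IsPMSpace {P : Set a} (τ : Topology P) (_≤_ : Rel P a) (ζ : P → P) :
                 Set (suc (suc a)) where
  open Topology τ
  field
    isPriestley  : IsPriestley τ _≤_
    [⟩-clopen    : ∀ {V} → V ∈ Clopen → Decreasing _≤_ V → [_⟩ _≤_ V ∈ Clopen
    ζ-continuous : Continuous τ τ ζ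
    ζ-antitone   : Antitonic₁ _≤_ _≤_ ζ
    ζ-involutive : Involutive _≡_ ζ

-- The disjoint union topology: a set is open iff both its traces are.

_⊎-topology_ : {X Y : Set a} → Topology X → Topology Y → Topology (X ⊎ Y)
_⊎-topology_ {a} {X} {Y} τ σ = record
  { Open   = λ V → inj₁ ⊢ V ∈ τ.Open × inj₂ ⊢ V ∈ σ.Open
  ; U-open = λ v → τ.U-open (λ x → v (inj₁ x)) , σ.U-open (λ y → v (inj₂ y))
  ; ∩-open = λ (v₁ , v₂) (w₁ , w₂) → τ.∩-open v₁ w₁ , σ.∩-open v₂ w₂
  ; ⋃-open = λ F F⊆ W≐⋃F →
      τ.⋃-open (trace inj₁ F) (λ { (V , V∈F , refl) → proj₁ (F⊆ V∈F) })
               (trace-union inj₁ F W≐⋃F) ,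
      σ.⋃-open (trace inj₂ F) (λ { (V , V∈F , refl) → proj₂ (F⊆ V∈F) })
               (trace-union inj₂ F W≐⋃F)
  }
  where
  module τ = Topology τ
  module σ = Topology σ

  trace : {Z : Set a} → (Z → X ⊎ Y) → Family (X ⊎ Y) → Family Z
  trace i F V′ = ∃ λ V → V ∈ F × V′ ≡ i ⊢ V

  trace-union : {Z : Set a} (i : Z → X ⊎ Y) (F : Family (X ⊎ Y)) →
                ∀ {W} → IsUnion F W → IsUnion (trace i F) (i ⊢ W)
  trace-union i F W≐⋃F z = mk⇔
    (λ w → let V , V∈F , v = Equivalence.to (W≐⋃F (i z)) w
           in i ⊢ V , (V , V∈F , refl) , v)
    (λ { (_ , (V , V∈F , refl) , v) →
         Equivalence.from (W≐⋃F (i z)) (V , V∈F , v) })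

-- Q₆(I, S): inj₁ embeds S, and inj₂ s is the copy ζ(s).

module Q₆ {S : Set a} (τS : Topology S) (I : Pred S a) where

  Carrier : Set a
  Carrier = S ⊎ S

  τ : Topology Carrier
  τ = τS ⊎-topology τS

  data _≺_ : Rel Carrier a where
    below : ∀ {x y} → x ≢ y ⊎ x ∉ I → inj₁ x ≺ inj₂ y

  _≤_ : Rel Carrier a
  _≤_ = ReflClosure _≺_

  ζ : Carrier → Carrier
  ζ = swap

{-# OPTIONS --safe #-}

-- The only case of total order disconnectedness that is not inherited from S
-- is x ≰ ζ(x) for x ∈ I; it is witnessed by (S ∖ {x}) ∪ {ζ(x)}, which is clopen
-- because x is isolated.  For a clopen set V, not necessarily decreasing, the
-- trace of [V⟩ on S is that of V.  If V contains some x ∈ S, then the trace of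
-- [V⟩ on ζ(S) contains every ζ(y) with y ≠ x, and also ζ(x) unless x ∈ I; so it
-- is either all of ζ(S) or the complement of a clopen point.

module Submission where

open import Defs
open import Level using (Level)
open import Axiom.ExcludedMiddle using (ExcludedMiddle)
import Data.Empty.Polymorphic as Polymorphic
open import Data.Fin.Base using (Fin; zero; suc)
open import Data.List.Base using ([]; _∷_; _++_)
open import Data.List.Relation.Unary.All using (All; []; _∷_)
import Data.List.Relation.Unary.All.Properties as All
open import Data.List.Relation.Unary.Any using (Any; here; there)
import Data.List.Relation.Unary.Any.Properties as Any
import Data.Nat.Base as ℕ
open import Data.Product.Base using (∃; _×_; _,_; proj₁; proj₂)
open import Data.Sum.Base as Sum using (_⊎_; inj₁; inj₂)
open import Data.Sum.Properties using (swap-involutive)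
open import Data.Unit.Polymorphic using (⊤; tt)
open import Function.Base using (_∘_; const)
open import Function.Bundles using (_↣_; mk⇔; Injection)
open import Relation.Binary.Construct.Closure.Reflexive using ([_]; refl)
open import Relation.Binary.Definitions using (Antitonic₁)
open import Relation.Binary.PropositionalEquality
  using (_≡_; _≢_; refl; sym; subst; isEquivalence)
open import Relation.Binary.Structures using (IsPartialOrder)
open import Relation.Nullary using (Dec; yes; no; ¬_; contradiction)
open import Relation.Nullary.Decidable using (decidable-stable)
open import Relation.Unary
  using (Pred; _∈_; _∉_; _⊆_; _≐_; ∁; Universal; Empty; ｛_｝; _⊢_)

private
  variable
    a : Level

module TopologyProperties {X : Set a} (τ : Topology X) where
  open Topology τ

  Open-resp-≐ : ∀ {V W} → V ≐ W → V ∈ Open → W ∈ Open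
  Open-resp-≐ {V} (V⊆W , W⊆V) V-open =
    ⋃-open ｛ V ｝ (λ { refl → V-open }) λ _ → mk⇔
      (λ w → V , refl , W⊆V w)
      (λ { (_ , refl , v) → V⊆W v })

  Clopen-resp-≐ : ∀ {V W} → V ≐ W → V ∈ Clopen → W ∈ Clopen
  Clopen-resp-≐ V≐W@(V⊆W , W⊆V) (V-open , V-closed) =
    Open-resp-≐ V≐W V-open ,
    Open-resp-≐ ((λ v∉ → v∉ ∘ W⊆V) , (λ w∉ → w∉ ∘ V⊆W)) V-closed

  Empty⇒Open : ∀ {V} → Empty V → V ∈ Open
  Empty⇒Open V-empty =
    ⋃-open (λ _ → Polymorphic.⊥) (λ ()) λ x → mk⇔
      (λ v → contradiction v (V-empty x))
      (λ ())

  Universal⇒Clopen : ∀ {V} → Universal V → V ∈ Clopen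
  Universal⇒Clopen V-universal =
    U-open V-universal , Empty⇒Open (λ x x∉V → x∉V (V-universal x))

  Empty⇒Clopen : ∀ {V} → Empty V → V ∈ Clopen
  Empty⇒Clopen V-empty = Empty⇒Open V-empty , U-open V-empty

  -- Closedness of `∁ V` means openness of the double complement, which excluded middle identifies
  -- with `V`.
  ∁-clopen : ExcludedMiddle a → ∀ {V} → V ∈ Clopen → ∁ V ∈ Clopen
  ∁-clopen em (V-open , V-closed) =
    V-closed , Open-resp-≐ ((λ v ¬v → ¬v v) , decidable-stable em) V-open

  -- The complement of a point is the union of all open sets that miss it: total disconnectedness
  -- puts every other point into one of them.
  IsStone⇒point-closed : IsStone τ → ∀ x → ｛ x ｝ ∈ Closed
  IsStone⇒point-closed stone x =
    ⋃-open (λ V → V ∈ Open × x ∉ V) proj₁ λ y → mk⇔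
      (λ x≢y → let V , (V-open , _) , y∈V , x∉V = totallyDisconnected (x≢y ∘ sym)
               in V , (V-open , x∉V) , y∈V)
      (λ { (V , (_ , x∉V) , y∈V) refl → x∉V y∈V })
    where open IsStone stone

traces : {X Z : Set a} → (Z → X) → Family X → Family Z
traces f F W = ∃ λ V → V ∈ F × W ≡ f ⊢ V

-- Compactness of a summand yields finitely many traces. Each carries the member of `F` it came
-- from, so a finite subfamily of `F` can be read off.
lift-traces : {X Z : Set a} (f : Z → X) (F : Family X) →
              ∀ {Ws} → All (_∈ traces f F) Ws →
              ∃ λ Vs → All (_∈ F) Vs ×
                       (∀ {z} → Any (z ∈_) Ws → Any (f z ∈_) Vs)
lift-traces f F [] = [] , [] , λ ()
lift-traces f F ((V , V∈F , refl) ∷ Ws⊆) =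
  let Vs , Vs⊆F , lifts = lift-traces f F Ws⊆
  in V ∷ Vs , V∈F ∷ Vs⊆F , λ { (here v) → here v ; (there w) → there (lifts w) }

-- The traces of a cover on each summand cover that summand; the two finite subcovers, lifted back
-- to `F`, together cover the sum.
⊎-compact : {X Y : Set a} (τ : Topology X) (σ : Topology Y) →
            Topology.Compact τ → Topology.Compact σ →
            Topology.Compact (τ ⊎-topology σ)
⊎-compact τ σ τ-compact σ-compact F F⊆ covers =
  let _ , Vs∈ , Vs-cover = τ-compact (traces inj₁ F)
        (λ { (_ , V∈F , refl) → proj₁ (F⊆ V∈F) }) (traces-cover inj₁)
      _ , Ws∈ , Ws-cover = σ-compact (traces inj₂ F)
        (λ { (_ , V∈F , refl) → proj₂ (F⊆ V∈F) }) (traces-cover inj₂)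
      Vs , Vs⊆F , liftV = lift-traces inj₁ F Vs∈
      Ws , Ws⊆F , liftW = lift-traces inj₂ F Ws∈
  in Vs ++ Ws , All.++⁺ Vs⊆F Ws⊆F ,
     Sum.[ (λ x → Any.++⁺ˡ (liftV (Vs-cover x)))
         , (λ y → Any.++⁺ʳ Vs (liftW (Ws-cover y))) ]
  where
  traces-cover : {Z : Set _} (i : Z → _) →
                 ∀ z → ∃ λ W → W ∈ traces i F × z ∈ W
  traces-cover i z =
    let V , V∈F , z∈V = covers (i z) in i ⊢ V , (V , V∈F , refl) , z∈V

⊎-clopen : {X Y : Set a} (τ : Topology X) (σ : Topology Y) →
           ∀ {A B} → A ∈ Topology.Clopen τ → B ∈ Topology.Clopen σ →
           Sum.[ A , B ] ∈ Topology.Clopen (τ ⊎-topology σ)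
⊎-clopen _ _ (A-open , A-closed) (B-open , B-closed) =
  (A-open , B-open) , (A-closed , B-closed)

module Q₆Properties (em : ExcludedMiddle a)
                    {S : Set a} (τS : Topology S) (stone : IsStone τS)
                    (I : Pred S a) (I-isolated : I ⊆ Topology.Isolated τS) where
  open Q₆ τS I
  open Topology τ using (Clopen)
  open TopologyProperties τS
  open IsStone stone
  private module τS = Topology τS

  point-clopen : ∀ {x} → x ∈ I → ｛ x ｝ ∈ τS.Clopen
  point-clopen x∈I = I-isolated x∈I , IsStone⇒point-closed stone _

  -- `_≺_` leads only from S to ζ(S), so two strict steps never compose and are never inverse to
  -- each other.
  ≤-isPartialOrder : IsPartialOrder _≡_ _≤_
  ≤-isPartialOrder = record
    { isPreorder = record
      { isEquivalence = isEquivalence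
      ; reflexive     = λ { refl → refl }
      ; trans         = λ { refl y≤z → y≤z
                          ; [ below x≺y ] refl → [ below x≺y ] }
      }
    ; antisym = λ { refl _ → refl ; [ below _ ] [ () ] }
    }

  separate : ∀ {x y} → ¬ (y ≤ x) →
             ∃ λ V → V ∈ Clopen × Decreasing _≤_ V × x ∈ V × y ∉ V
  -- Points of S are minimal, so every subset of S is decreasing; this covers the first two cases.
  separate {inj₁ x} {inj₁ y} y≰x =
    let A , A-clopen , x∈A , y∉A = totallyDisconnected λ { refl → y≰x refl }
    in Sum.[ A , const Polymorphic.⊥ ] ,
       ⊎-clopen τS τS A-clopen (Empty⇒Clopen λ _ ()) ,
       (λ { refl v → v ; [ below _ ] () }) , x∈A , y∉A
  separate {inj₁ x} {inj₂ y} y≰x =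
    Sum.[ const ⊤ , const Polymorphic.⊥ ] ,
    ⊎-clopen τS τS (Universal⇒Clopen _) (Empty⇒Clopen λ _ ()) ,
    (λ { refl v → v ; [ below _ ] () }) , tt , λ ()
  -- Any subset of ζ(S) becomes decreasing once all of S is added.
  separate {inj₂ x} {inj₂ y} y≰x =
    let A , A-clopen , x∈A , y∉A = totallyDisconnected λ { refl → y≰x refl }
    in Sum.[ const ⊤ , A ] ,
       ⊎-clopen τS τS (Universal⇒Clopen _) A-clopen ,
       (λ { refl v → v ; [ below _ ] _ → tt }) , x∈A , y∉A
  separate {inj₂ x} {inj₁ y} y≰x =
    Sum.[ ∁ ｛ x ｝ , ｛ x ｝ ] ,
    ⊎-clopen τS τS (∁-clopen em x-clopen) x-clopen ,
    -- The only point of S left out is x, and x is not below ζ(x) because x ∈ I.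
    (λ { refl v → v
       ; [ below (inj₁ z≢x) ] refl refl → z≢x refl
       ; [ below (inj₂ z∉I) ] refl refl → z∉I x∈I }) ,
    refl , λ x≢y → x≢y (sym y≡x)
    where
    -- Either disjunct in `below` would put y below ζ(x), so both fail.
    y≡x : y ≡ x
    y≡x = decidable-stable em λ y≢x → y≰x [ below (inj₁ y≢x) ]

    x∈I : x ∈ I
    x∈I = subst (_∈ I) y≡x (decidable-stable em λ y∉I → y≰x [ below (inj₂ y∉I) ])

    x-clopen : ｛ x ｝ ∈ τS.Clopen
    x-clopen = point-clopen x∈I

  inj₂-[⟩-clopen : ∀ {V} → inj₂ ⊢ V ∈ τS.Clopen →
                   inj₂ ⊢ [_⟩ _≤_ V ∈ τS.Clopen
  inj₂-[⟩-clopen {V} V₂-clopen with em {∃ λ x → inj₁ x ∈ V}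
  -- Points of ζ(S) have nothing strictly above them, so the trace on ζ(S) does not grow.
  ... | no V₁-empty = Clopen-resp-≐
    ( (λ v → _ , v , refl)
    , (λ { (_ , v , refl) → v
         ; (_ , v , [ below _ ]) → contradiction (_ , v) V₁-empty }))
    V₂-clopen
  -- The split is on ζ(x) itself rather than on x ∈ I: even for x ∈ I, ζ(x) may belong to `V` or lie
  -- above another point of `V`.
  ... | yes (x , x∈V) with em {inj₂ x ∈ [_⟩ _≤_ V}
  ...   | yes ζx∈ = Universal⇒Clopen λ y → reaches y em
    where
    reaches : ∀ y → Dec (x ≡ y) → inj₂ y ∈ [_⟩ _≤_ V
    reaches y (yes refl) = ζx∈
    reaches y (no x≢y)   = inj₁ x , x∈V , [ below (inj₁ x≢y) ]
  ...   | no ζx∉ = Clopen-resp-≐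
    ( (λ x≢y → inj₁ x , x∈V , [ below (inj₁ x≢y) ])
    , (λ { y∈ refl → ζx∉ y∈ }))
    (∁-clopen em (point-clopen x∈I))
    where
    x∈I : x ∈ I
    x∈I = decidable-stable em λ x∉I → ζx∉ (inj₁ x , x∈V , [ below (inj₂ x∉I) ])

  [⟩-clopen : ∀ {V} → V ∈ Clopen → [_⟩ _≤_ V ∈ Clopen
  [⟩-clopen {V} ((V₁-open , V₂-open) , (V₁-closed , V₂-closed)) =
    (proj₁ inj₁-clopen , proj₁ inj₂-clopen) ,
    (proj₂ inj₁-clopen , proj₂ inj₂-clopen)
    where
    inj₁-clopen : inj₁ ⊢ [_⟩ _≤_ V ∈ τS.Clopen
    -- By minimality, a point of S is above a member of `V` only by being that member.
    inj₁-clopen = Clopen-resp-≐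
      ((λ v → _ , v , refl) , (λ { (_ , v , refl) → v }))
      (V₁-open , V₁-closed)

    inj₂-clopen : inj₂ ⊢ [_⟩ _≤_ V ∈ τS.Clopen
    inj₂-clopen = inj₂-[⟩-clopen (V₂-open , V₂-closed)

  -- The condition for x < ζ(y) is symmetric in x and y: inequality is symmetric, and when x = y the
  -- condition is carried over unchanged. The case split is needed because x ∉ I alone says nothing
  -- about y.
  ζ-antitone : Antitonic₁ _≤_ _≤_ ζ
  ζ-antitone refl = refl
  ζ-antitone [ below {x} {y} x≢y⊎x∉I ] with em {x ≡ y}
  ... | no x≢y   = [ below (inj₁ (x≢y ∘ sym)) ]
  ... | yes refl = [ below x≢y⊎x∉I ]

  isPMSpace : IsPMSpace τ _≤_ ζ
  isPMSpace = record
    { isPriestley  = record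
      { isPartialOrder           = ≤-isPartialOrder
      ; compact                  = ⊎-compact τS τS compact compact
      ; totallyOrderDisconnected = separate
      }
    ; [⟩-clopen    = λ V-clopen _ → [⟩-clopen V-clopen
    ; ζ-continuous = λ (V₁-open , V₂-open) → V₂-open , V₁-open
    ; ζ-antitone   = ζ-antitone
    ; ζ-involutive = swap-involutive
    }

module _ {S : Set a} (τS : Topology S) (I : Pred S a) where
  open Q₆ τS I

  chain₁ : ∀ {x y} → x ≢ y → Chain _≤_ 1
  chain₁ {x} {y} x≢y = c , λ {i} {j} → c-mono {i} {j}
    where
    c : Fin 2 → Carrier
    c zero    = inj₁ x
    c (suc _) = inj₂ y

    c-mono : ∀ {i j} → _ → _
    c-mono {zero}     {suc zero} _           = [ below (inj₁ x≢y) ] , λ ()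
    c-mono {suc zero} {suc zero} (ℕ.s≤s ())

  -- A strict step ends in ζ(S), where no strict step begins, so the first three elements of a
  -- longer chain already give a contradiction.
  chain-length≤1 : ∀ m → Chain _≤_ m → m ℕ.≤ 1
  chain-length≤1 0 _ = ℕ.z≤n
  chain-length≤1 1 _ = ℕ.s≤s ℕ.z≤n
  chain-length≤1 (ℕ.suc (ℕ.suc m)) (c , c-mono) =
    contradiction (c-mono {suc zero} {suc (suc zero)} (ℕ.s≤s (ℕ.s≤s ℕ.z≤n)))
      (no-3-chain (c-mono {zero} {suc zero} (ℕ.s≤s ℕ.z≤n)))
    where
    no-3-chain : ∀ {u v w} → u ≤ v × u ≢ v → ¬ (v ≤ w × v ≢ w)
    no-3-chain (refl        , u≢v) _             = u≢v refl
    no-3-chain ([ below _ ] , _)   (refl , v≢w)  = v≢w refl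

  hasHeight-1 : ∀ {x y} → x ≢ y → HasHeight _≤_ 1
  hasHeight-1 x≢y = chain₁ x≢y , chain-length≤1

theorem4p7 : ∀ {a : Level} → ExcludedMiddle a →
    {S : Set a} (τS : Topology S) → IsStone τS → Fin 3 ↣ S →
    (I : Pred S a) → I ⊆ Topology.Isolated τS →
    IsPMSpace (Q₆.τ τS I) (Q₆._≤_ τS I) (Q₆.ζ τS I) × HasHeight (Q₆._≤_ τS I) 1
theorem4p7 em τS stone three I I-isolated =
  isPMSpace ,
  hasHeight-1 τS I {to zero} {to (suc zero)} λ eq → contradiction (injective eq) λ ()
  where
  open Q₆Properties em τS stone I I-isolated
  open Injection three
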